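{- Let $n\ge2$ and $k\ge1$ be integers. Then \[ \gamma_{[k]R}(C_7\Box P_n)\le\begin{cases}(n+1)(k+1)+\frac{n-1}{2}(k+1)+2k,& n\text{ odd},\\[2pt] n(k+1)+\frac n2(k+1)+2k+1,& n\text{ even}.\end{cases} \]
   Context: For a graph $G$ and $v\in V(G)$, $N(v)$ is the open neighborhood and $N[v]=N(v)\cup\{v\}$. For an integer $k\ge1$, a function $f:V(G)\to\{0,1,\dots,k+1\}$ is a $[k]$-Roman dominating function if for every vertex $v$ with $f(v)<k$ we have $\sum_{u\in N[v]}f(u)\ge k+|\{u\in N(v): f(u)>0\}|$. The weight of $f$ is $\sum_{v}f(v)$, and $\gamma_{[k]R}(G)$ is the minimum weight of a $[k]$-Roman dominating function on $G$. $C_m\Box P_n$ is the Cartesian product of the cycle $C_m$ (vertices $0,\dots,m-1$ mod $m$) and the path $P_n$ (vertices $0,\dots,n-1$): $(i,j)\sim(i',j')$ iff ($i=i'$ and $|j-j'|=1$) or ($j=j'$ and $i'\equiv i\pm1 \pmod m$). -}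

module Defs where

open import Data.Nat using (ℕ; zero; suc; _+_; _*_; _∸_; _≤_; _<_; _≡ᵇ_; _/_; _%_)
open import Data.Bool using (Bool; true; false; _∧_; _∨_; if_then_else_; _≟_)
open import Data.Fin using (Fin; toℕ)
open import Data.Nat.ListAction using (sum)
open import Data.List using (List; map; filter; length; allFin; cartesianProduct)
open import Data.Product using (_×_; _,_; proj₁; proj₂)
open import Relation.Nullary using (Dec; yes; no)
open import Data.Nat using (_<?_)

-- Vertices of C_m □ P_n : pairs (i , j) with i ∈ Z_m (cycle), j ∈ {0..n-1} (path).
Vertex : ℕ → ℕ → Set
Vertex m n = Fin m × Fin n

vertices : (m n : ℕ) → List (Vertex m n)
vertices m n = cartesianProduct (allFin m) (allFin n)

adj : (m n : ℕ) → Vertex m n → Vertex m n → Bool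
adj m n (i , j) (i' , j') =
  ((toℕ i ≡ᵇ toℕ i') ∧ ((suc (toℕ j) ≡ᵇ toℕ j') ∨ (suc (toℕ j') ≡ᵇ toℕ j)))
  ∨ ((toℕ j ≡ᵇ toℕ j') ∧ ((toℕ i' ≡ᵇ (suc (toℕ i) % suc m')) ∨ (toℕ i ≡ᵇ (suc (toℕ i') % suc m'))))
  where
  m' : ℕ
  m' = m ∸ 1

N : (m n : ℕ) → Vertex m n → List (Vertex m n)
N m n v = filter (λ u → adj m n v u ≟ true) (vertices m n)

pos : ℕ → ℕ
pos zero = 0
pos (suc _) = 1

record IsKRDF (k m n : ℕ) (f : Vertex m n → ℕ) : Set where
  field
    range : ∀ v → f v ≤ k + 1
    cond  : ∀ v → f v < k →
            k + sum (map (λ u → pos (f u)) (N m n v))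
              ≤ f v + sum (map f (N m n v))

weight : (m n : ℕ) → (Vertex m n → ℕ) → ℕ
weight m n f = sum (map f (vertices m n))

-- The bound of the theorem.  For odd n, (n-1)/2 = ⌊n/2⌋.
bound : ℕ → ℕ → ℕ
bound n k with n % 2
... | zero  = n * (k + 1) + (n / 2) * (k + 1) + 2 * k + 1
... | suc _ = (n + 1) * (k + 1) + (n / 2) * (k + 1) + 2 * k

{-# OPTIONS --safe #-}

-- Write K = k + 1.  In C₇ □ P_n put K on rows t + 2 and t + 4 of column 2t and on row t of
-- column 2t + 1 (rows mod 7).  Every vertex away from the two ends then has a K in its closed
-- neighbourhood, at a cost of 3K per two columns.  In column 0 only row 6 is left undominated:
-- it gets label k.  If the last column is 2t, only its row t is left, which again gets k; if it
-- is 2t + 1, rows t + 3 and t + 5 are left, and one more K on row t + 4 dominates both.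
-- Two more columns amount to rotating the rows by one, so all claims reduce to finite checks.
module Submission where

open import Defs
open import Data.Bool using (true) renaming (_≟_ to _≟ᴮ_)
open import Data.Bool.Properties using (T-≡; ∨-zeroʳ)
open import Data.Empty using (⊥)
open import Data.Fin using (Fin; zero; suc; toℕ; fromℕ<; _≟_)
open import Data.Fin.Patterns using (0F; 1F; 2F; 3F; 4F; 5F; 6F)
open import Data.Fin.Properties using (all?; toℕ<n; toℕ-fromℕ<)
open import Data.List using (List; []; _∷_; map; _++_; allFin; cartesianProduct; tabulate)
open import Data.List.Membership.Propositional using (_∈_)
open import Data.List.Membership.Propositional.Properties
  using (∈-filter⁺; ∈-cartesianProduct⁺; ∈-allFin)
open import Data.List.Properties using (map-++; map-∘; map-tabulate; tabulate-cong)
open import Data.List.Relation.Unary.Any using (here; there)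
open import Data.Nat using (ℕ; zero; suc; _+_; _*_; _∸_; _/_; _%_; _≤_; _<_; z≤n; s≤s; _≡ᵇ_)
open import Data.Nat.DivMod using (_mod_; m/n≡1+[m∸n]/n)
open import Data.Nat.ListAction using (sum)
open import Data.Nat.ListAction.Properties using (sum-++)
open import Data.Nat.Properties
  using (+-suc; +-comm; +-identityʳ; +-mono-≤; +-monoʳ-≤; ≤-pred; ≤-reflexive; <-trans; <-irrefl;
         <-asym; >⇒≢; n<1+n; m≤m+n; m≤n⇒m≤o+n; m+[n∸m]≡n; m∸n≢0⇒n<m; ≡⇒≡ᵇ; module ≤-Reasoning)
  renaming (_≟_ to _≟ᴺ_)
open import Data.Nat.Tactic.RingSolver using (solve-∀)
open import Data.Product using (Σ; ∃; _×_; _,_)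
open import Data.Sum using (_⊎_; inj₁; inj₂; map₂) renaming (map to ⊎-map)
open import Data.Vec using (lookup) renaming ([] to ⟨⟩; _∷_ to _,-_)
open import Function using (_∘_; id)
open import Function.Bundles using (Equivalence)
open import Relation.Binary.PropositionalEquality
open import Relation.Nullary using (Dec; no; ¬?; contradiction; from-yes; _⊎-dec_; _→-dec_)

-- Finite sums over lists

sum-map-+ : ∀ {A : Set} (f g : A → ℕ) xs →
  sum (map f xs) + sum (map g xs) ≡ sum (map (λ x → f x + g x) xs)
sum-map-+ f g []       = refl
sum-map-+ f g (x ∷ xs) =
  trans (swap (f x) (sum (map f xs)) (g x) (sum (map g xs)))
        (cong (f x + g x +_) (sum-map-+ f g xs))
  where
  swap : ∀ a b c d → a + b + (c + d) ≡ a + c + (b + d)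
  swap = solve-∀

sum-map-0 : ∀ {A : Set} (xs : List A) → sum (map (λ _ → 0) xs) ≡ 0
sum-map-0 []       = refl
sum-map-0 (_ ∷ xs) = sum-map-0 xs

-- Exchanges the order of summation: the product list runs row by row, whereas the weight is
-- computed column by column.
sum-cartesianProduct : ∀ {A B : Set} (f : A × B → ℕ) xs ys →
  sum (map f (cartesianProduct xs ys)) ≡ sum (map (λ y → sum (map (λ x → f (x , y)) xs)) ys)
sum-cartesianProduct f []       ys = sym (sum-map-0 ys)
sum-cartesianProduct f (x ∷ xs) ys = begin
  sum (map f (map (x ,_) ys ++ rest))
    ≡⟨ cong sum (map-++ f (map (x ,_) ys) rest) ⟩
  sum (map f (map (x ,_) ys) ++ map f rest)
    ≡⟨ sum-++ (map f (map (x ,_) ys)) (map f rest) ⟩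
  sum (map f (map (x ,_) ys)) + sum (map f rest)
    ≡⟨ cong₂ _+_ (cong sum (sym (map-∘ ys))) (sum-cartesianProduct f xs ys) ⟩
  sum (map (λ y → f (x , y)) ys) + sum (map (λ y → sum (map (λ x → f (x , y)) xs)) ys)
    ≡⟨ sum-map-+ _ _ ys ⟩
  sum (map (λ y → sum (map (λ x → f (x , y)) (x ∷ xs))) ys) ∎
  where
  open ≡-Reasoning
  rest = cartesianProduct xs ys

pos≤ : ∀ n → pos n ≤ n
pos≤ zero    = z≤n
pos≤ (suc n) = s≤s z≤n

sum-pos≤ : ∀ {A : Set} (f : A → ℕ) xs → sum (map (λ x → pos (f x)) xs) ≤ sum (map f xs)
sum-pos≤ f []       = z≤n
sum-pos≤ f (x ∷ xs) = +-mono-≤ (pos≤ (f x)) (sum-pos≤ f xs)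

-- The element of value `suc k` adds 1 to the count of positive values and `k` more than that to the
-- sum; every other element adds at least as much to the sum as to the count.
k+sum-pos≤ : ∀ {A : Set} {k u} (f : A → ℕ) {xs} → u ∈ xs → f u ≡ suc k →
  k + sum (map (λ x → pos (f x)) xs) ≤ sum (map f xs)
k+sum-pos≤ {k = k} f {x ∷ xs} (here refl) fu rewrite fu | +-suc k (sum (map (pos ∘ f) xs)) =
  s≤s (+-monoʳ-≤ k (sum-pos≤ f xs))
k+sum-pos≤ {k = k} f {x ∷ xs} (there u∈) fu = begin
  k + (pos (f x) + s)  ≡⟨ +-comm-middle k (pos (f x)) s ⟩
  pos (f x) + (k + s)  ≤⟨ +-mono-≤ (pos≤ (f x)) (k+sum-pos≤ f u∈ fu) ⟩
  f x + sum (map f xs) ∎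
  where
  open ≤-Reasoning
  s = sum (map (pos ∘ f) xs)
  +-comm-middle : ∀ a b c → a + (b + c) ≡ b + (a + c)
  +-comm-middle = solve-∀

-- The labels 0, k and k + 1, kept symbolic so that finite checks do not depend on k.
Label : Set
Label = Fin 3

pattern ∅  = 0F
pattern κ  = 1F
pattern κ⁺ = 2F

value : ℕ → Label → ℕ
value k ∅  = 0
value k κ  = k
value k κ⁺ = suc k

-- Column patterns and their rotation

Column : Set
Column = Fin 7 → Label

next prev : Fin 7 → Fin 7
next i = suc (toℕ i) mod 7
prev i = (6 + toℕ i) mod 7

next-prev : ∀ i → next (prev i) ≡ prev (next i)
next-prev = from-yes (all? λ i → next (prev i) ≟ prev (next i))

initial : Column
initial = lookup (∅ ,- ∅ ,- κ⁺ ,- ∅ ,- κ⁺ ,- ∅ ,- κ ,- ⟨⟩)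

-- Recursion in steps of two makes the rotation by one row hold by computation. `final 0` serves as
-- the seed of the even final columns, since column 0 itself is `initial`.
interior final : ℕ → Column
interior 0             = lookup (∅ ,- ∅ ,- κ⁺ ,- ∅ ,- κ⁺ ,- ∅ ,- ∅ ,- ⟨⟩)
interior 1             = lookup (κ⁺ ,- ∅ ,- ∅ ,- ∅ ,- ∅ ,- ∅ ,- ∅ ,- ⟨⟩)
interior (suc (suc j)) = interior j ∘ prev
final 0                = lookup (κ ,- ∅ ,- κ⁺ ,- ∅ ,- κ⁺ ,- ∅ ,- ∅ ,- ⟨⟩)
final 1                = lookup (κ⁺ ,- ∅ ,- ∅ ,- ∅ ,- κ⁺ ,- ∅ ,- ∅ ,- ⟨⟩)
final (suc (suc j))    = final j ∘ prev

-- Column j when r further columns follow it.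
column : ℕ → ℕ → Column
column zero    _       = initial
column (suc j) zero    = final (suc j)
column (suc j) (suc r) = interior (suc j)

interior⊆final : ∀ j i → interior j i ≡ κ⁺ → final j i ≡ κ⁺
interior⊆final 0 = from-yes (all? λ i → (interior 0 i ≟ κ⁺) →-dec (final 0 i ≟ κ⁺))
interior⊆final 1 = from-yes (all? λ i → (interior 1 i ≟ κ⁺) →-dec (final 1 i ≟ κ⁺))
interior⊆final (suc (suc j)) i = interior⊆final j (prev i)

-- The end columns only add to the `κ⁺` entries of the interior pattern. Domination from a
-- neighbouring column can therefore be checked against `interior`, whether or not that column is an
-- end.
interior⊆column : ∀ j r i → interior j i ≡ κ⁺ → column j r i ≡ κ⁺
interior⊆column zero    r       =
  from-yes (all? λ i → (interior 0 i ≟ κ⁺) →-dec (initial i ≟ κ⁺))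
interior⊆column (suc j) zero    = interior⊆final (suc j)
interior⊆column (suc j) (suc r) = λ _ → id

-- L and R say that the left and right neighbours carry κ⁺.
Dominated : Column → Fin 7 → Set → Set → Set
Dominated c i L R = c i ≢ ∅ ⊎ c (prev i) ≡ κ⁺ ⊎ c (next i) ≡ κ⁺ ⊎ L ⊎ R

dominated? : ∀ c i {L R} → Dec L → Dec R → Dec (Dominated c i L R)
dominated? c i L? R? =
  ¬? (c i ≟ ∅) ⊎-dec ((c (prev i) ≟ κ⁺) ⊎-dec ((c (next i) ≟ κ⁺) ⊎-dec (L? ⊎-dec R?)))

dominated-rotate : ∀ c i {L R} → Dominated c (prev i) L R → Dominated (c ∘ prev) i L R
-- Only the `next` alternative needs transport, as `prev` has to move past `next`; the others agree
-- by computation.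
dominated-rotate c i = map₂ (map₂ (⊎-map (trans (cong c (sym (next-prev i)))) id))

dominated-map : ∀ c i {L R L′ R′} → (L → L′) → (R → R′) →
  Dominated c i L R → Dominated c i L′ R′
dominated-map c i l r = map₂ (map₂ (map₂ (⊎-map l r)))

initial-dominated : ∀ i → Dominated initial i ⊥ (interior 1 i ≡ κ⁺)
initial-dominated = from-yes (all? λ i → dominated? initial i (no id) (interior 1 i ≟ κ⁺))

interior-dominated : ∀ j i →
  Dominated (interior (1 + j)) i (interior j i ≡ κ⁺) (interior (2 + j) i ≡ κ⁺)
interior-dominated 0 =
  from-yes (all? λ i → dominated? (interior 1) i (interior 0 i ≟ κ⁺) (interior 2 i ≟ κ⁺))
interior-dominated 1 =
  from-yes (all? λ i → dominated? (interior 2) i (interior 1 i ≟ κ⁺) (interior 3 i ≟ κ⁺))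
interior-dominated (suc (suc j)) i =
  dominated-rotate (interior (1 + j)) i (interior-dominated j (prev i))

final-dominated : ∀ j i → Dominated (final (1 + j)) i (interior j i ≡ κ⁺) ⊥
final-dominated 0 = from-yes (all? λ i → dominated? (final 1) i (interior 0 i ≟ κ⁺) (no id))
final-dominated 1 = from-yes (all? λ i → dominated? (final 2) i (interior 1 i ≟ κ⁺) (no id))
final-dominated (suc (suc j)) i =
  dominated-rotate (final (1 + j)) i (final-dominated j (prev i))

-- The hypothesis `0 < j + r` excludes the path with a single column, where `initial` would have no
-- right neighbour.
column-dominated : ∀ j r i → 0 < j + r →
  Dominated (column j r) i
    (∃ λ j′ → suc j′ ≡ j × interior j′ i ≡ κ⁺)
    (0 < r × interior (suc j) i ≡ κ⁺)
column-dominated zero    (suc r) i _ = dominated-map initial i (λ ()) (s≤s z≤n ,_) (initial-dominated i)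
column-dominated (suc j) zero    i _ =
  dominated-map (final (suc j)) i (λ p → j , refl , p) (λ ()) (final-dominated j i)
column-dominated (suc j) (suc r) i _ =
  dominated-map (interior (suc j)) i (λ p → j , refl , p) (s≤s z≤n ,_) (interior-dominated j i)

-- Adjacency and domination in the graph

≡ᵇ-true : ∀ {m n} → m ≡ n → (m ≡ᵇ n) ≡ true
≡ᵇ-true {m} {n} eq = Equivalence.to T-≡ (≡⇒≡ᵇ m n eq)

adj-next : ∀ {n} i (j : Fin n) → adj 7 n (i , j) (next i , j) ≡ true
adj-next i j
  rewrite ≡ᵇ-true {toℕ j} refl
        | ≡ᵇ-true (from-yes (all? λ i → toℕ (next i) ≟ᴺ suc (toℕ i) % 7) i)
  = ∨-zeroʳ _

adj-prev : ∀ {n} i (j : Fin n) → adj 7 n (i , j) (prev i , j) ≡ true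
adj-prev i j
  rewrite ≡ᵇ-true {toℕ j} refl
        | ≡ᵇ-true (from-yes (all? λ i → toℕ i ≟ᴺ suc (toℕ (prev i)) % 7) i)
        | ∨-zeroʳ (toℕ (prev i) ≡ᵇ suc (toℕ i) % 7)
  = ∨-zeroʳ _

adj-right : ∀ {n} i {j j′ : Fin n} → suc (toℕ j) ≡ toℕ j′ → adj 7 n (i , j) (i , j′) ≡ true
adj-right i eq rewrite ≡ᵇ-true {toℕ i} refl | ≡ᵇ-true eq = refl

adj-left : ∀ {n} i {j j′ : Fin n} → suc (toℕ j′) ≡ toℕ j → adj 7 n (i , j) (i , j′) ≡ true
adj-left i {j} {j′} eq
  rewrite ≡ᵇ-true {toℕ i} refl | ≡ᵇ-true eq | ∨-zeroʳ (suc (toℕ j) ≡ᵇ toℕ j′) = refl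

∈-N : ∀ {n} (v u : Vertex 7 n) → adj 7 n v u ≡ true → u ∈ N 7 n v
∈-N {n} v (i , j) =
  ∈-filter⁺ (λ u → adj 7 n v u ≟ᴮ true) (∈-cartesianProduct⁺ (∈-allFin i) (∈-allFin j))

label : ∀ n → Vertex 7 n → Label
label n (i , j) = column (toℕ j) (n ∸ suc (toℕ j)) i

label-dominated : ∀ n v → 2 ≤ n → label n v ≡ ∅ → ∃ λ u → u ∈ N 7 n v × label n u ≡ κ⁺
label-dominated n (i , j) 2≤n lv with column-dominated (toℕ j) (n ∸ suc (toℕ j)) i 0<j+r
  where
  0<j+r : 0 < toℕ j + (n ∸ suc (toℕ j))
  -- Here `n` is `suc (toℕ j)` plus the number of columns that follow.
  0<j+r = ≤-pred (subst (2 ≤_) (sym (m+[n∸m]≡n (toℕ<n j))) 2≤n)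
... | inj₁ lv≢∅               = contradiction lv lv≢∅
... | inj₂ (inj₁ p)           = (prev i , j) , ∈-N (i , j) _ (adj-prev i j) , p
... | inj₂ (inj₂ (inj₁ p))    = (next i , j) , ∈-N (i , j) _ (adj-next i j) , p
... | inj₂ (inj₂ (inj₂ (inj₁ (j′ , 1+j′≡j , p)))) =
  (i , fromℕ< j′<n) , ∈-N (i , j) _ (adj-left i {j} (trans (cong suc toℕ-j′) 1+j′≡j)) ,
  interior⊆column (toℕ (fromℕ< j′<n)) _ i (trans (cong (λ y → interior y i) toℕ-j′) p)
  where
  j′<n : j′ < n
  j′<n = <-trans (≤-reflexive 1+j′≡j) (toℕ<n j)
  toℕ-j′ = toℕ-fromℕ< j′<n
... | inj₂ (inj₂ (inj₂ (inj₂ (0<r , p)))) =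
  (i , fromℕ< 1+j<n) , ∈-N (i , j) _ (adj-right i {j} (sym toℕ-1+j)) ,
  interior⊆column (toℕ (fromℕ< 1+j<n)) _ i (trans (cong (λ y → interior y i) toℕ-1+j) p)
  where
  1+j<n : suc (toℕ j) < n
  1+j<n = m∸n≢0⇒n<m (>⇒≢ 0<r)
  toℕ-1+j = toℕ-fromℕ< 1+j<n

value≤ : ∀ k l → value k l ≤ k + 1
value≤ k ∅  = z≤n
value≤ k κ  = m≤m+n k 1
value≤ k κ⁺ = ≤-reflexive (+-comm 1 k)

-- The label `κ` has value exactly `k`, so the Roman condition asks nothing there; this is why `k`
-- suffices at an undominated end vertex.
value<k⇒∅ : ∀ k l → value k l < k → l ≡ ∅
value<k⇒∅ k ∅  _ = refl
value<k⇒∅ k κ  p = contradiction p (<-irrefl refl)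
value<k⇒∅ k κ⁺ p = contradiction p (<-asym (n<1+n k))

label-isKRDF : ∀ n k → 2 ≤ n → IsKRDF k 7 n (value k ∘ label n)
label-isKRDF n k 2≤n = record
  { range = λ v → value≤ k (label n v)
  ; cond  = λ v fv<k →
      let u , u∈N , lu = label-dominated n v 2≤n (value<k⇒∅ k (label n v) fv<k)
      in m≤n⇒m≤o+n _ (k+sum-pos≤ (value k ∘ label n) u∈N (cong (value k) lu))
  }

-- The weight and the bound

columnWeight : ℕ → Column → ℕ
columnWeight k c = sum (map (value k ∘ c) (allFin 7))

columnWeight-rotate : ∀ k c → columnWeight k (c ∘ prev) ≡ columnWeight k c
columnWeight-rotate k c =
  -- The sum over seven rows computes to explicit terms; the rotated one starts with `v 6F` because
  -- `prev 0F` is `6F`.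
  rotate (v 0F) (v 1F) (v 2F) (v 3F) (v 4F) (v 5F) (v 6F)
  where
  v = value k ∘ c
  rotate : ∀ a b c d e f g →
    g + (a + (b + (c + (d + (e + (f + 0)))))) ≡ a + (b + (c + (d + (e + (f + (g + 0))))))
  rotate = solve-∀

-- Total weight of the columns j, …, j + r, the last of which ends the path.
tailWeight : ℕ → ℕ → ℕ → ℕ
tailWeight k j zero    = columnWeight k (final j)
tailWeight k j (suc r) = columnWeight k (interior j) + tailWeight k (suc j) r

tailWeight-rotate : ∀ k j r → tailWeight k (2 + j) r ≡ tailWeight k j r
tailWeight-rotate k j zero    = columnWeight-rotate k (final j)
tailWeight-rotate k j (suc r) =
  cong₂ _+_ (columnWeight-rotate k (interior j)) (tailWeight-rotate k (suc j) r)

-- Starting at `suc j` avoids `initial`; from column 1 on, `column` unfolds to `interior` or `final`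
-- just as `tailWeight` does.
sum-columns : ∀ k j r →
  sum (tabulate λ (x : Fin (suc r)) → columnWeight k (column (suc j + toℕ x) (r ∸ toℕ x)))
    ≡ tailWeight k (suc j) r
sum-columns k j zero rewrite +-identityʳ j = +-identityʳ _
sum-columns k j (suc r) =
  cong₂ _+_ (cong (λ y → columnWeight k (interior (suc y))) (+-identityʳ j))
    (trans (cong sum (tabulate-cong λ (x : Fin (suc r)) →
              cong (λ y → columnWeight k (column (suc y) (r ∸ toℕ x))) (+-suc j (toℕ x))))
           (sum-columns k (suc j) r))

weight-label : ∀ m k →
  weight 7 (2 + m) (value k ∘ label (2 + m)) ≡ columnWeight k initial + tailWeight k 1 m
weight-label m k = begin
  weight 7 (2 + m) (value k ∘ label (2 + m))
    ≡⟨ sum-cartesianProduct (value k ∘ label (2 + m)) (allFin 7) (allFin (2 + m)) ⟩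
  sum (map columnWeightAt (allFin (2 + m)))
    ≡⟨ cong sum (map-tabulate id columnWeightAt) ⟩
  columnWeight k initial + sum (tabulate (columnWeightAt ∘ suc))
    ≡⟨ cong (columnWeight k initial +_) (sum-columns k 0 m) ⟩
  columnWeight k initial + tailWeight k 1 m ∎
  where
  open ≡-Reasoning
  columnWeightAt : Fin (2 + m) → ℕ
  columnWeightAt j = columnWeight k (column (toℕ j) (2 + m ∸ suc (toℕ j)))

-- `(2 + n) % 2` computes to `n % 2`, so one split settles both bounds; the quotient accumulates and
-- needs a rewrite.
bound-step : ∀ n k → bound (2 + n) k ≡ 3 * suc k + bound n k
bound-step n k with n % 2
... | zero  rewrite m/n≡1+[m∸n]/n {2 + n} {2} (s≤s (s≤s z≤n)) = even n k (n / 2)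
  where
  even : ∀ n k h → (2 + n) * (k + 1) + (1 + h) * (k + 1) + 2 * k + 1
    ≡ 3 * suc k + (n * (k + 1) + h * (k + 1) + 2 * k + 1)
  even = solve-∀
... | suc _ rewrite m/n≡1+[m∸n]/n {2 + n} {2} (s≤s (s≤s z≤n)) = odd n k (n / 2)
  where
  odd : ∀ n k h → (2 + n + 1) * (k + 1) + (1 + h) * (k + 1) + 2 * k
    ≡ 3 * suc k + ((n + 1) * (k + 1) + h * (k + 1) + 2 * k)
  odd = solve-∀

bound-exact : ∀ m k → columnWeight k initial + tailWeight k 1 m ≡ bound (2 + m) k
bound-exact 0 = base
  where
  base : ∀ k → suc k + (suc k + (k + 0)) + (suc k + (suc k + 0))
    ≡ 2 * (k + 1) + 1 * (k + 1) + 2 * k + 1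
  base = solve-∀
bound-exact 1 = base
  where
  base : ∀ k → suc k + (suc k + (k + 0)) + (suc k + 0 + (k + (suc k + (suc k + 0))))
    ≡ (3 + 1) * (k + 1) + 1 * (k + 1) + 2 * k
  base = solve-∀
bound-exact (suc (suc m)) k = begin
  I + tailWeight k 1 (2 + m)
    ≡⟨⟩
  -- Columns 1 and 2 split off, with one and two entries `suc k`; the tail from column 3 is a
  -- rotated tail from column 1.
  I + (suc k + 0 + (suc k + (suc k + 0) + tailWeight k 3 m))
    ≡⟨ step I k (tailWeight k 3 m) ⟩
  3 * suc k + (I + tailWeight k 3 m)
    ≡⟨ cong (λ t → 3 * suc k + (I + t)) (tailWeight-rotate k 1 m) ⟩
  3 * suc k + (I + tailWeight k 1 m)
    ≡⟨ cong (3 * suc k +_) (bound-exact m k) ⟩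
  3 * suc k + bound (2 + m) k
    ≡⟨ bound-step (2 + m) k ⟨
  bound (4 + m) k ∎
  where
  open ≡-Reasoning
  I = columnWeight k initial
  step : ∀ i k t → i + (suc k + 0 + (suc k + (suc k + 0) + t)) ≡ 3 * suc k + (i + t)
  step = solve-∀

theorem14 : (n k : ℕ) → 2 ≤ n → 1 ≤ k →
    Σ (Vertex 7 n → ℕ) (λ f → IsKRDF k 7 n f × weight 7 n f ≤ bound n k)
theorem14 (suc zero)    k (s≤s ()) _
theorem14 (suc (suc m)) k 2≤n      _ =
  value k ∘ label (2 + m) , label-isKRDF (2 + m) k 2≤n ,
  ≤-reflexive (trans (weight-label m k) (bound-exact m k))
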